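{- Let $0<\alpha<1$ and let $d\geq 1$ be an integer. There exists $N_0(\alpha,d)$ such that for every integer $N\geq N_0(\alpha,d)$, every subset $A\subseteq\{1,\dots,N\}$ of size $\alpha N$ contains a non-trivial $d$-configuration.
   Context: A $d$-configuration is a set of the form $\{n_i+n_j+a\}_{1\leq i\leq j\leq d}$ with $a,n_1,\dots,n_d\in\mathbb{N}$. It is non-trivial if $n_i\neq n_j$ for all $i\neq j$. A set $A$ contains the configuration if all of the numbers $n_i+n_j+a$ ($1\le i\le j\le d$) lie in $A$. -}

module Defs where

open import Data.Nat using (ℕ; _+_; _≤_)
open import Data.Integer using (+_)
open import Data.Rational using (ℚ; _/_)
open import Data.Fin using (Fin) renaming (_≤_ to _≤ᶠ_)
open import Data.List using (List; length)
open import Data.List.Membership.Propositional using (_∈_)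
open import Data.List.Relation.Unary.All using (All)
open import Data.List.Relation.Unary.Unique.Propositional using (Unique)
open import Data.Product using (_×_; ∃)
open import Relation.Binary.PropositionalEquality using (_≡_)
open import Relation.Nullary using (¬_)

ℕ→ℚ : ℕ → ℚ
ℕ→ℚ n = + n / 1

IsSubsetOfInterval : ℕ → List ℕ → Set
IsSubsetOfInterval N A = Unique A × All (λ x → 1 ≤ x × x ≤ N) A

ContainsConfig : (d : ℕ) → List ℕ → ℕ → (Fin d → ℕ) → Set
ContainsConfig d A a n = ∀ (i j : Fin d) → i ≤ᶠ j → n i + n j + a ∈ A

NonTrivial : (d : ℕ) → (Fin d → ℕ) → Set
NonTrivial d n = ∀ (i j : Fin d) → ¬ i ≡ j → ¬ n i ≡ n j

ContainsNonTrivialConfig : (d : ℕ) → List ℕ → Set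
ContainsNonTrivialConfig d A =
  ∃ λ (a : ℕ) → ∃ λ (n : Fin d → ℕ) → NonTrivial d n × ContainsConfig d A a n

{-# OPTIONS --safe #-}
module Submission where

open import Defs
open import Data.Nat using (ℕ; zero; suc; _+_; _*_; _∸_; _≤_; _<_; z≤n; s≤s; NonZero; >-nonZero)
open import Data.Nat.DivMod using (_/_; _%_; m≡m%n+[m/n]*n; m%n<n)
open import Data.Nat.Properties
open import Data.Nat.Tactic.RingSolver using (solve-∀)
open import Data.Bool using (Bool; true; false; T; _∧_; not)
open import Data.Bool.Properties using (T-∧)
open import Data.Rational using (ℚ; 0ℚ; 1ℚ) renaming (_*_ to _*ℚ_; _<_ to _<ℚ_; _≤_ to _≤ℚ_)
open import Data.Rational.Unnormalised using (mkℚᵘ; *≤*)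
open import Data.List using (List; []; _∷_; length)
open import Data.List.Membership.DecPropositional _≟_ using (_∈?_)
open import Data.List.Relation.Unary.All as All using (All; []; _∷_)
open import Data.List.Relation.Unary.Any using (here; there)
open import Data.List.Relation.Unary.Unique.Propositional using (Unique; []; _∷_)
open import Data.Fin using (toℕ)
open import Data.Fin.Properties using (toℕ-injective; toℕ≤pred[n])
import Data.Integer as ℤ
import Data.Integer.Properties as ℤ
import Data.Rational as ℚ
import Data.Rational.Properties as ℚ
import Data.Rational.Unnormalised.Properties as ℚᵘ
open import Data.Product using (∃; ∃₂; _×_; _,_; proj₁; proj₂)
open import Data.Sum using (inj₁; inj₂)
open import Data.Empty using (⊥; ⊥-elim)
open import Function using (_∘_; Equivalence)
open import Relation.Binary.Definitions using (tri<; tri≈; tri>)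
open import Relation.Nullary using (¬_; Dec; yes; no; contradiction)
open import Relation.Nullary.Decidable using (⌊_⌋; T?; _×-dec_; toWitness; fromWitness)
open import Relation.Binary.PropositionalEquality using (_≡_; refl; sym; trans; cong; cong₂; subst; subst₂)

-- It is enough to prove Roth's theorem: by averaging, some set A′ = {x : x, x + r, x + 2r ∈ A} with
-- r > 0 is then dense, and iterating this d − 1 times yields a and r₁, …, r_{d-1} > 0 such that A contains
-- a + c₁ r₁ + … + c_{d-1} r_{d-1} for all cᵢ ∈ {0,1,2}; the partial sums of the rᵢ serve as the nᵢ.
-- Roth's theorem is proved by Szemerédi's combinatorial density increment. If A has no 3-AP, the
-- reflections 2q − p of p ∈ A∩[0,u) in the points q of a set B ⊆ A∩[u,2u) miss A. Thinning B to
-- B ∩ (B − h) with popular h cannot shrink the set of reflections substantially every time, and when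
-- it does not, the reflections in B ∩ (B − h) form a set S nearly closed under adding g = 2h. Then the
-- complement of S nearly is a union of long progressions with difference g, so A is denser than before
-- on one of them.

-- Linear arithmetic without subtraction: q − p = (b − a) + k.
linear : ∀ {a b p q} k → a ≤ b → p + b + k ≡ q + a → p ≤ q
linear {a} {b} {p} {q} k a≤b eq = +-cancelʳ-≤ a p q (begin
  p + a      ≤⟨ +-monoʳ-≤ p a≤b ⟩
  p + b      ≤⟨ m≤m+n (p + b) k ⟩
  p + b + k  ≡⟨ eq ⟩
  q + a      ∎)
  where open ≤-Reasoning

-- Finite sums over initial segments.

∑ : ℕ → (ℕ → ℕ) → ℕ
∑ zero    f = 0
∑ (suc n) f = ∑ n f + f n

∑-mono : ∀ n {f g} → (∀ x → x < n → f x ≤ g x) → ∑ n f ≤ ∑ n g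
∑-mono zero    f≤g = z≤n
∑-mono (suc n) f≤g =
  +-mono-≤ (∑-mono n (λ x x<n → f≤g x (m<n⇒m<1+n x<n))) (f≤g n ≤-refl)

∑-cong : ∀ n {f g} → (∀ x → f x ≡ g x) → ∑ n f ≡ ∑ n g
∑-cong zero    f≡g = refl
∑-cong (suc n) f≡g = cong₂ _+_ (∑-cong n f≡g) (f≡g n)

∑-distrib-+ : ∀ n f g → ∑ n (λ x → f x + g x) ≡ ∑ n f + ∑ n g
∑-distrib-+ zero    f g = refl
∑-distrib-+ (suc n) f g =
  trans (cong (_+ (f n + g n)) (∑-distrib-+ n f g)) (eq (∑ n f) (∑ n g) (f n) (g n))
  where
  eq : ∀ a b c d → a + b + (c + d) ≡ a + c + (b + d)
  eq = solve-∀

∑-distribˡ-* : ∀ c n f → ∑ n (λ x → c * f x) ≡ c * ∑ n f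
∑-distribˡ-* c zero    f = sym (*-zeroʳ c)
∑-distribˡ-* c (suc n) f =
  trans (cong (_+ c * f n) (∑-distribˡ-* c n f)) (sym (*-distribˡ-+ c (∑ n f) (f n)))

∑-const : ∀ n c → ∑ n (λ _ → c) ≡ n * c
∑-const zero    c = refl
∑-const (suc n) c = trans (cong (_+ c) (∑-const n c)) (+-comm (n * c) c)

∑-swap : ∀ m n (f : ℕ → ℕ → ℕ) → ∑ m (λ x → ∑ n (f x)) ≡ ∑ n (λ y → ∑ m (λ x → f x y))
∑-swap zero    n f = sym (trans (∑-const n 0) (*-zeroʳ n))
∑-swap (suc m) n f =
  trans (cong (_+ ∑ n (f m)) (∑-swap m n f)) (sym (∑-distrib-+ n _ _))

∑-bound : ∀ n {f c} → (∀ x → x < n → f x ≤ c) → ∑ n f ≤ n * c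
∑-bound n {c = c} f≤c = ≤-trans (∑-mono n f≤c) (≤-reflexive (∑-const n c))

∑-zero : ∀ n {f} → (∀ x → x < n → f x ≤ 0) → ∑ n f ≤ 0
∑-zero n f≤0 = ≤-trans (∑-bound n f≤0) (≤-reflexive (*-zeroʳ n))

∑-split : ∀ m n f → ∑ (n + m) f ≡ ∑ m f + ∑ n (λ x → f (x + m))
∑-split m zero    f = sym (+-identityʳ _)
∑-split m (suc n) f =
  trans (cong (_+ f (n + m)) (∑-split m n f)) (+-assoc (∑ m f) _ _)

∑-extend : ∀ {m n} f → m ≤ n → ∑ m f ≤ ∑ n f
∑-extend {m} {n} f m≤n = begin
  ∑ m f              ≤⟨ m≤m+n _ _ ⟩
  ∑ m f + _          ≡⟨ ∑-split m (n ∸ m) f ⟨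
  ∑ (n ∸ m + m) f    ≡⟨ cong (λ k → ∑ k f) (m∸n+n≡m m≤n) ⟩
  ∑ n f              ∎
  where open ≤-Reasoning

∑-term : ∀ {x n} f → x < n → f x ≤ ∑ n f
∑-term {x} f x<n = ≤-trans (m≤n+m (f x) (∑ x f)) (∑-extend f x<n)

∑-shift-lower : ∀ c n {f} → (∀ x → f x ≤ 1) → ∑ (n + c) f ≤ c + ∑ n (λ x → f (x + c))
∑-shift-lower c n {f} f≤1 = begin
  ∑ (n + c) f                      ≡⟨ ∑-split c n f ⟩
  ∑ c f + ∑ n (λ x → f (x + c))    ≤⟨ +-monoˡ-≤ _ (∑-bound c (λ x _ → f≤1 x)) ⟩
  c * 1 + ∑ n (λ x → f (x + c))    ≡⟨ cong (_+ ∑ n (λ x → f (x + c))) (*-identityʳ c) ⟩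
  c + ∑ n (λ x → f (x + c))        ∎
  where open ≤-Reasoning

∑-shift-upper : ∀ c n f → ∑ n (λ x → f (x + c)) ≤ ∑ (n + c) f
∑-shift-upper c n f = ≤-trans (m≤n+m _ (∑ c f)) (≤-reflexive (sym (∑-split c n f)))

∑-shift-vanish : ∀ c n f → (∀ x → n ≤ x → f x ≤ 0) → ∑ n (λ x → f (x + c)) ≤ ∑ n f
∑-shift-vanish c n f f≤0 = begin
  ∑ n (λ x → f (x + c))            ≤⟨ ∑-shift-upper c n f ⟩
  ∑ (n + c) f                      ≡⟨ cong (λ k → ∑ k f) (+-comm n c) ⟩
  ∑ (c + n) f                      ≡⟨ ∑-split n c f ⟩
  ∑ n f + ∑ c (λ x → f (x + n))    ≤⟨ +-monoʳ-≤ (∑ n f) (∑-zero c (λ x _ → f≤0 (x + n) (m≤n+m n x))) ⟩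
  ∑ n f + 0                        ≡⟨ +-identityʳ _ ⟩
  ∑ n f                            ∎
  where open ≤-Reasoning

-- If no `r` works, every `suc (c * m * f r)` is at most `n`. Summing over `r < m` gives `m + c * m
-- * ∑ m f ≤ m * n ≤ c * m * ∑ m f`, so `m` is 0, the sum is empty and `n` is 0.
∑-pigeonhole : ∀ c m n f → 0 < n → n ≤ c * ∑ m f → ∃ λ r → r < m × n ≤ c * m * f r
∑-pigeonhole c m n f 0<n n≤ with anyUpTo? (λ r → n ≤? c * m * f r) m
... | yes found = found
... | no  none  = contradiction 0<n (≤⇒≯ n≤0)
  where
  open ≤-Reasoning
  small : ∑ m (λ r → suc (c * m * f r)) ≤ m * n
  small = ∑-bound m (λ r r<m → ≰⇒> (λ big → none (r , r<m , big)))
  eq : ∀ a b d → b * (a * d) + b * 1 ≡ b * 1 + a * b * d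
  eq = solve-∀
  m≤0 : m * 1 ≤ 0
  m≤0 = +-cancelʳ-≤ (c * m * ∑ m f) (m * 1) 0 (begin
    m * 1 + c * m * ∑ m f                        ≡⟨ cong₂ _+_ (∑-const m 1) (∑-distribˡ-* (c * m) m f) ⟨
    ∑ m (λ _ → 1) + ∑ m (λ r → c * m * f r)      ≡⟨ ∑-distrib-+ m _ _ ⟨
    ∑ m (λ r → suc (c * m * f r))                ≤⟨ small ⟩
    m * n                                        ≤⟨ *-monoʳ-≤ m n≤ ⟩
    m * (c * ∑ m f)                              ≡⟨ trans (sym (*-assoc m c _)) (cong (_* ∑ m f) (*-comm m c)) ⟩
    c * m * ∑ m f                                ∎)
  n≤0 : n ≤ 0
  n≤0 = begin
    n                 ≤⟨ n≤ ⟩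
    c * ∑ m f         ≡⟨ cong (λ k → c * ∑ k f) (trans (sym (*-identityʳ m)) (n≤0⇒n≡0 m≤0)) ⟩
    c * 0             ≡⟨ *-zeroʳ c ⟩
    0                 ∎

-- Counting with Boolean indicators.

ind : Bool → ℕ
ind false = 0
ind true  = 1

ind≤1 : ∀ b → ind b ≤ 1
ind≤1 false = z≤n
ind≤1 true  = ≤-refl

ind-mono : ∀ {b c} → (T b → T c) → ind b ≤ ind c
ind-mono {false}         _   = z≤n
ind-mono {true}  {true}  _   = ≤-refl
ind-mono {true}  {false} b⇒c = ⊥-elim (b⇒c _)

T⇒1≤ind : ∀ {b} → T b → 1 ≤ ind b
T⇒1≤ind {true} _ = ≤-refl

¬T⇒ind≤0 : ∀ {b} → ¬ T b → ind b ≤ 0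
¬T⇒ind≤0 {false} _  = z≤n
¬T⇒ind≤0 {true}  ¬b = ⊥-elim (¬b _)

infix 8 #_⟨_⟩

#_⟨_⟩ : ℕ → (ℕ → Bool) → ℕ
# n ⟨ B ⟩ = ∑ n (λ x → ind (B x))

count-witness : ∀ n B → 1 ≤ # n ⟨ B ⟩ → ∃ λ i → i < n × T (B i)
count-witness (suc n) B 1≤ with T? (B n)
... | yes Bn = n , ≤-refl , Bn
... | no ¬Bn =
  let i , i<n , Bi = count-witness n B (≤-trans 1≤
        (≤-trans (+-monoʳ-≤ (# n ⟨ B ⟩) (¬T⇒ind≤0 ¬Bn)) (≤-reflexive (+-identityʳ _))))
  in i , m<n⇒m<1+n i<n , Bi

count-pair : ∀ n B → 2 ≤ # n ⟨ B ⟩ → ∃₂ λ i j → i < j × j < n × T (B i) × T (B j)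
count-pair (suc n) B 2≤ with T? (B n)
... | yes Bn =
  let i , i<n , Bi = count-witness n B (+-cancelʳ-≤ 1 1 _
        (≤-trans 2≤ (+-monoʳ-≤ (# n ⟨ B ⟩) (ind≤1 (B n)))))
  in i , n , i<n , ≤-refl , Bi , Bn
... | no ¬Bn =
  let i , j , i<j , j<n , Bi , Bj = count-pair n B (≤-trans 2≤
        (≤-trans (+-monoʳ-≤ (# n ⟨ B ⟩) (¬T⇒ind≤0 ¬Bn)) (≤-reflexive (+-identityʳ _))))
  in i , j , i<j , m<n⇒m<1+n j<n , Bi , Bj

-- Supersaturation, popular differences and descent.

-- Double counting over the windows `[y, y + W)` with `y < N`. Here `b r x` says that a pattern with
-- parameter `r` starts at `x`, and every window on which `A` has density above 1/(2K) contains such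
-- a start. The sparse windows account for at most about half of `A`, so starts are plentiful, and
-- pigeonholing over `r` makes one pattern popular.
supersaturation : ∀ K W (A : ℕ → Bool) (b : ℕ → ℕ → Bool) N →
  .{{_ : NonZero W}} → 0 < N → 4 * K * W ≤ N →
  (∀ x → T (A x) → x < N) →
  (∀ r x → T (b r x) → T (A x)) →
  (∀ y → W < 2 * K * # W ⟨ (λ i → A (y + i)) ⟩ → ∃₂ λ r i → r < W × i < W × T (b r (y + i))) →
  N ≤ K * # N ⟨ A ⟩ → ∃ λ r → r < W × N ≤ 4 * K * W * W * # N ⟨ b r ⟩
supersaturation K W A b N 0<N 4KW≤N A<N b⊆A hits dense =
  ∑-pigeonhole (4 * K * W) W N (λ r → # N ⟨ b r ⟩) 0<N N≤
  where
  open ≤-Reasoning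
  X = ∑ W (λ r → # N ⟨ b r ⟩)
  P : ℕ → ℕ
  P y = ∑ W (λ r → # W ⟨ (λ i → b r (y + i)) ⟩)

  -- A sparse window is paid for by `W`. A dense one has at most `W` points and contains a hit, so
  -- `P y` is at least 1 and pays for all of them.
  pointwise : ∀ y → 2 * K * # W ⟨ (λ i → A (y + i)) ⟩ ≤ W + 2 * K * W * P y
  pointwise y with W <? 2 * K * # W ⟨ (λ i → A (y + i)) ⟩
  ... | no  W≮ = ≤-trans (≮⇒≥ W≮) (m≤m+n W _)
  ... | yes W< with hits y W<
  ...   | r , i , r<W , i<W , hit = begin
    2 * K * # W ⟨ (λ i → A (y + i)) ⟩  ≤⟨ *-monoʳ-≤ (2 * K) (∑-bound W (λ i _ → ind≤1 (A (y + i)))) ⟩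
    2 * K * (W * 1)                    ≡⟨ trans (cong (2 * K *_) (*-identityʳ W)) (sym (*-identityʳ _)) ⟩
    2 * K * W * 1                      ≤⟨ *-monoʳ-≤ (2 * K * W) 1≤P ⟩
    2 * K * W * P y                    ≤⟨ m≤n+m _ W ⟩
    W + 2 * K * W * P y                ∎
    where
    1≤P : 1 ≤ P y
    1≤P = begin
      1                                ≤⟨ T⇒1≤ind hit ⟩
      ind (b r (y + i))                ≤⟨ ∑-term (λ i → ind (b r (y + i))) i<W ⟩
      # W ⟨ (λ i → b r (y + i)) ⟩      ≤⟨ ∑-term (λ r → # W ⟨ (λ i → b r (y + i)) ⟩) r<W ⟩
      P y                              ∎

  -- For each offset `i < W`, only the points of `A` below `i` are missed by `y + i`, hence at most
  -- `W` points.
  lower : W * # N ⟨ A ⟩ ≤ W * W + ∑ N (λ y → # W ⟨ (λ i → A (y + i)) ⟩)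
  lower = begin
    W * # N ⟨ A ⟩                                          ≡⟨ ∑-const W _ ⟨
    ∑ W (λ _ → # N ⟨ A ⟩)                                  ≤⟨ ∑-mono W shift ⟩
    ∑ W (λ i → W + ∑ N (λ y → ind (A (y + i))))            ≡⟨ ∑-distrib-+ W _ _ ⟩
    ∑ W (λ _ → W) + ∑ W (λ i → ∑ N (λ y → ind (A (y + i)))) ≡⟨ cong₂ _+_ (∑-const W W) (∑-swap W N _) ⟩
    W * W + ∑ N (λ y → # W ⟨ (λ i → A (y + i)) ⟩)          ∎
    where
    shift : ∀ i → i < W → # N ⟨ A ⟩ ≤ W + ∑ N (λ y → ind (A (y + i)))
    shift i i<W = begin
      # N ⟨ A ⟩                          ≤⟨ ∑-extend _ (m≤m+n N i) ⟩
      # (N + i) ⟨ A ⟩                    ≤⟨ ∑-shift-lower i N (λ x → ind≤1 (A x)) ⟩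
      i + ∑ N (λ y → ind (A (y + i)))    ≤⟨ +-monoˡ-≤ _ (<⇒≤ i<W) ⟩
      W + ∑ N (λ y → ind (A (y + i)))    ∎

  upper : ∑ N P ≤ W * X
  upper = begin
    ∑ N P                                                          ≡⟨ ∑-swap N W _ ⟩
    ∑ W (λ r → ∑ N (λ y → # W ⟨ (λ i → b r (y + i)) ⟩))            ≡⟨ ∑-cong W (λ r → ∑-swap N W _) ⟩
    ∑ W (λ r → ∑ W (λ i → ∑ N (λ y → ind (b r (y + i)))))
      ≤⟨ ∑-mono W (λ r _ → ∑-bound W (λ i _ → ∑-shift-vanish i N _ (λ x N≤x →
           ¬T⇒ind≤0 (λ bx → <⇒≱ (A<N x (b⊆A r x bx)) N≤x)))) ⟩
    ∑ W (λ r → W * # N ⟨ b r ⟩)                                    ≡⟨ ∑-distribˡ-* W W _ ⟩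
    W * X                                                          ∎

  scaled : W * (2 * K * # N ⟨ A ⟩) ≤ W * (2 * K * W + N + 2 * K * W * X)
  scaled = begin
    W * (2 * K * # N ⟨ A ⟩)                              ≡⟨ eq₁ W K (# N ⟨ A ⟩) ⟩
    2 * K * (W * # N ⟨ A ⟩)                              ≤⟨ *-monoʳ-≤ (2 * K) lower ⟩
    2 * K * (W * W + ∑ N (λ y → # W ⟨ (λ i → A (y + i)) ⟩))
      ≡⟨ trans (*-distribˡ-+ (2 * K) _ _) (cong (2 * K * (W * W) +_) (sym (∑-distribˡ-* (2 * K) N _))) ⟩
    2 * K * (W * W) + ∑ N (λ y → 2 * K * # W ⟨ (λ i → A (y + i)) ⟩)
      ≤⟨ +-monoʳ-≤ (2 * K * (W * W)) (∑-mono N (λ y _ → pointwise y)) ⟩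
    2 * K * (W * W) + ∑ N (λ y → W + 2 * K * W * P y)
      ≡⟨ cong (2 * K * (W * W) +_) (trans (∑-distrib-+ N _ _) (cong₂ _+_ (∑-const N W) (∑-distribˡ-* (2 * K * W) N P))) ⟩
    2 * K * (W * W) + (N * W + 2 * K * W * ∑ N P)
      ≤⟨ +-monoʳ-≤ (2 * K * (W * W)) (+-monoʳ-≤ (N * W) (*-monoʳ-≤ (2 * K * W) upper)) ⟩
    2 * K * (W * W) + (N * W + 2 * K * W * (W * X))      ≡⟨ eq₂ W K N X ⟩
    W * (2 * K * W + N + 2 * K * W * X)                  ∎
    where
    eq₁ : ∀ w k x → w * (2 * k * x) ≡ 2 * k * (w * x)
    eq₁ = solve-∀
    eq₂ : ∀ w k n x → 2 * k * (w * w) + (n * w + 2 * k * w * (w * x)) ≡ w * (2 * k * w + n + 2 * k * w * x)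
    eq₂ = solve-∀

  N≤ : N ≤ 4 * K * W * X
  -- Density gives `2 * N ≤ 2 * K * # N ⟨ A ⟩`, hence `N ≤ 2 * K * W + 2 * K * W * X`, and
  -- `4 * K * W ≤ N` absorbs the first summand into half of `N`.
  N≤ = linear 0 (+-mono-≤ (+-mono-≤ 4KW≤N (*-monoʳ-≤ 2 (*-cancelˡ-≤ W scaled))) (*-monoʳ-≤ 4 dense))
         (eq N K W X (# N ⟨ A ⟩))
    where
    eq : ∀ n k w x a → n + (n + 2 * (2 * k * w + n + 2 * k * w * x) + 4 * (k * a)) + 0
       ≡ 4 * k * w * x + (4 * k * w + 2 * (2 * k * a) + 4 * n)
    eq = solve-∀

positive-factor : ∀ k {m n} → 0 < n → n ≤ k * m → 0 < m
positive-factor k {zero}  0<n n≤ = contradiction (≤-trans n≤ (≤-reflexive (*-zeroʳ k))) (<⇒≱ 0<n)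
positive-factor k {suc m} _   _  = s≤s z≤n

abstract
  -- In a window of length `2 * K`, density above 1/(2K) means at least two points, and their
  -- difference is the pattern counted by `supersaturation`.
  popular-difference : ∀ K → .{{_ : NonZero K}} → ∃₂ λ H K′ → NonZero K′ × ∀ N B →
    0 < N → H ≤ N → (∀ x → T (B x) → x < N) → N ≤ K * # N ⟨ B ⟩ →
    ∃ λ h → 1 ≤ h × h ≤ H × N ≤ K′ * # N ⟨ (λ x → B x ∧ B (x + h)) ⟩
  -- The first constant is the threshold `4 * K * W` with `W = 2 * K`; it also bounds the
  -- difference, which is at most `2 * K`.
  popular-difference K = 4 * K * (2 * K) , 4 * K * (2 * K) * (2 * K) ,
    m*n≢0 (4 * K * (2 * K)) (2 * K) {{m*n≢0 (4 * K) (2 * K) {{m*n≢0 4 K}} {{m*n≢0 2 K}}}} {{m*n≢0 2 K}} ,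
    λ N B 0<N big B<N dense →
      let r , r<2K , N≤ = supersaturation K (2 * K) B (λ r x → B x ∧ B (x + suc r)) N {{m*n≢0 2 K}}
            0<N big B<N (λ r x → proj₁ ∘ Equivalence.to T-∧) (pair B) dense
      in suc r , s≤s z≤n , ≤-trans r<2K (m≤n*m (2 * K) (4 * K) {{m*n≢0 4 K}}) , N≤
    where
    pair : ∀ (B : ℕ → Bool) y → 2 * K < 2 * K * # (2 * K) ⟨ (λ i → B (y + i)) ⟩ →
      ∃₂ λ r i → r < 2 * K × i < 2 * K × T (B (y + i) ∧ B (y + i + suc r))
    pair B y many =
      let i , j , i<j , j<n , Bi , Bj = count-pair (2 * K) (λ i → B (y + i))
            (*-cancelˡ-< (2 * K) 1 _ (≤-trans (s≤s (≤-reflexive (*-identityʳ (2 * K)))) many))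
          i+r≡j : i + suc (j ∸ suc i) ≡ j
          i+r≡j = trans (+-suc i _) (m+[n∸m]≡n i<j)
      in j ∸ suc i , i , ≤-<-trans (m∸n≤m j (suc i)) j<n , <-trans i<j j<n ,
         Equivalence.from T-∧ (Bi , subst (T ∘ B) (sym (trans (+-assoc y i _) (cong (y +_) i+r≡j))) Bj)

-- Szemerédi's descent: among the sets obtained from B by repeatedly intersecting with a popular
-- translate, the size functional τ can drop by more than θ only M times.
descent : ∀ M K → .{{_ : NonZero K}} → ∃ λ H → ∀ N B (τ : (ℕ → Bool) → ℕ) θ →
  0 < N → H ≤ N → (∀ x → T (B x) → x < N) → N ≤ K * # N ⟨ B ⟩ → τ B ≤ M * θ →
  ∃₂ λ B₁ B₂ → ∃ λ h → 1 ≤ h × h ≤ H × 1 ≤ # N ⟨ B₂ ⟩ ×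
    (∀ x → T (B₁ x) → T (B x)) × (∀ x → T (B₂ x) → T (B₁ x) × T (B₁ (x + h))) × τ B₁ ≤ τ B₂ + θ
descent M K with popular-difference K
-- For `M = 0` the hypothesis says that `τ B` is 0, so any popular translate satisfies the last
-- inequality.
descent zero K | H , K′ , _ , popular = H , λ N B τ θ 0<N H≤N B<N dense τ≤ →
  let h , 1≤h , h≤H , dense′ = popular N B 0<N H≤N B<N dense
  in B , (λ x → B x ∧ B (x + h)) , h , 1≤h , h≤H , positive-factor K′ 0<N dense′ ,
     (λ _ Bx → Bx) , (λ _ → Equivalence.to T-∧) , ≤-trans τ≤ z≤n
descent (suc M) K | H , K′ , K′≢0 , popular with descent M K′ {{K′≢0}}
... | H′ , continue = H + H′ , step
  where
  step : ∀ N B (τ : (ℕ → Bool) → ℕ) θ →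
    0 < N → H + H′ ≤ N → (∀ x → T (B x) → x < N) → N ≤ K * # N ⟨ B ⟩ → τ B ≤ suc M * θ →
    ∃₂ λ B₁ B₂ → ∃ λ h → 1 ≤ h × h ≤ H + H′ × 1 ≤ # N ⟨ B₂ ⟩ ×
      (∀ x → T (B₁ x) → T (B x)) × (∀ x → T (B₂ x) → T (B₁ x) × T (B₁ (x + h))) × τ B₁ ≤ τ B₂ + θ
  step N B τ θ 0<N H≤N B<N dense τ≤ with popular N B 0<N (m+n≤o⇒m≤o H H≤N) B<N dense
  ... | h , 1≤h , h≤H , dense′ with τ B ≤? τ (λ x → B x ∧ B (x + h)) + θ
  ...   | yes τ≤τ₂ =
    B , (λ x → B x ∧ B (x + h)) , h , 1≤h , ≤-trans h≤H (m≤m+n H H′) , positive-factor K′ 0<N dense′ ,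
    (λ _ Bx → Bx) , (λ _ → Equivalence.to T-∧) , τ≤τ₂
  ...   | no τ≰τ₂ =
    -- A drop of more than `θ` leaves at most `M * θ` for the thinned set, whose density constant is
    -- now `K′`.
    let B₁ , B₂ , h′ , 1≤h′ , h′≤H′ , B₂≢∅ , B₁⊆ , rest =
          continue N (λ x → B x ∧ B (x + h)) τ θ 0<N (m+n≤o⇒n≤o H H≤N)
            (λ x → B<N x ∘ proj₁ ∘ Equivalence.to T-∧) dense′
            (+-cancelʳ-≤ θ _ _ (≤-trans (<⇒≤ (≰⇒> τ≰τ₂)) (≤-trans τ≤ (≤-reflexive (+-comm θ (M * θ))))))
    in B₁ , B₂ , h′ , 1≤h′ , ≤-trans h′≤H′ (m≤n+m H′ H) , B₂≢∅ ,
       (λ x → proj₁ ∘ Equivalence.to T-∧ ∘ B₁⊆ x) , rest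

-- Windows, blocks and reflections of sums.

∑-tail : ∀ n d {f} → (∀ x → f x ≤ 1) → ∑ (n + d) f ≤ ∑ n f + d
∑-tail n d {f} f≤1 = begin
  ∑ (n + d) f                      ≡⟨ cong (λ k → ∑ k f) (+-comm n d) ⟩
  ∑ (d + n) f                      ≡⟨ ∑-split n d f ⟩
  ∑ n f + ∑ d (λ x → f (x + n))    ≤⟨ +-monoʳ-≤ (∑ n f) (∑-bound d (λ x _ → f≤1 (x + n))) ⟩
  ∑ n f + d * 1                    ≡⟨ cong (∑ n f +_) (*-identityʳ d) ⟩
  ∑ n f + d                        ∎
  where open ≤-Reasoning

-- The window `[c, n + c)` misses `c` terms of `[0, n + e)` on the left and `e ∸ c` on the right.
∑-window : ∀ n {c e f} → (∀ x → f x ≤ 1) → c ≤ e → ∑ (n + e) f ≤ e + ∑ n (λ x → f (x + c))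
∑-window n {c} {e} {f} f≤1 c≤e = begin
  ∑ (n + e) f                              ≡⟨ cong (λ k → ∑ k f) n+e ⟩
  ∑ (n + (e ∸ c) + c) f                    ≤⟨ ∑-shift-lower c (n + (e ∸ c)) f≤1 ⟩
  c + ∑ (n + (e ∸ c)) (λ x → f (x + c))    ≤⟨ +-monoʳ-≤ c (∑-tail n (e ∸ c) (λ x → f≤1 (x + c))) ⟩
  c + (∑ n (λ x → f (x + c)) + (e ∸ c))    ≡⟨ eq c _ (e ∸ c) ⟩
  c + (e ∸ c) + ∑ n (λ x → f (x + c))      ≡⟨ cong (_+ ∑ n (λ x → f (x + c))) (m+[n∸m]≡n c≤e) ⟩
  e + ∑ n (λ x → f (x + c))                ∎
  where
  open ≤-Reasoning
  n+e : n + e ≡ n + (e ∸ c) + c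
  n+e = trans (cong (n +_) (sym (m∸n+n≡m c≤e))) (sym (+-assoc n (e ∸ c) c))
  eq : ∀ a b d → a + (b + d) ≡ a + d + b
  eq = solve-∀

-- Cut `[0, n)` into an initial piece of length `n % L`, bounded trivially, followed by full blocks
-- of length `L`.
∑-blocks : ∀ c e L n f → .{{_ : NonZero L}} → (∀ x → f x ≤ 1) →
  (∀ x → x + L ≤ n → c * ∑ L (λ i → f (i + x)) ≤ e * L) → c * ∑ n f ≤ e * n + c * L
∑-blocks c e L n f f≤1 block = subst (λ k → c * ∑ k f ≤ e * k + c * L) (sym n≡)
  (≤-trans (go (n / L) ≤-refl) (+-mono-≤ (*-monoʳ-≤ e (m≤m+n _ r)) (*-monoʳ-≤ c (<⇒≤ (m%n<n n L)))))
  where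
  open ≤-Reasoning
  r = n % L
  n≡ : n ≡ n / L * L + r
  n≡ = trans (m≡m%n+[m/n]*n n L) (+-comm r _)
  go : ∀ q → q ≤ n / L → c * ∑ (q * L + r) f ≤ e * (q * L) + c * r
  go zero    _   = begin
    c * ∑ r f           ≤⟨ *-monoʳ-≤ c (∑-bound r (λ x _ → f≤1 x)) ⟩
    c * (r * 1)         ≡⟨ cong (c *_) (*-identityʳ r) ⟩
    c * r               ≤⟨ m≤n+m _ (e * 0) ⟩
    e * 0 + c * r       ∎
  go (suc q) q<  = begin
    c * ∑ (L + q * L + r) f                                            ≡⟨ cong (λ k → c * ∑ k f) (+-assoc L _ r) ⟩
    c * ∑ (L + (q * L + r)) f                                          ≡⟨ cong (c *_) (∑-split (q * L + r) L f) ⟩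
    c * (∑ (q * L + r) f + ∑ L (λ i → f (i + (q * L + r))))            ≡⟨ *-distribˡ-+ c _ _ ⟩
    c * ∑ (q * L + r) f + c * ∑ L (λ i → f (i + (q * L + r)))
      ≤⟨ +-mono-≤ (go q (<⇒≤ q<)) (block (q * L + r) fits) ⟩
    e * (q * L) + c * r + e * L                                        ≡⟨ eq e (q * L) (c * r) L ⟩
    e * (L + q * L) + c * r                                            ∎
    where
    eq : ∀ a b d l → a * b + d + a * l ≡ a * (l + b) + d
    eq = solve-∀
    fits : q * L + r + L ≤ n
    fits = begin
      q * L + r + L      ≡⟨ trans (+-comm _ L) (sym (+-assoc L _ r)) ⟩
      suc q * L + r      ≤⟨ +-monoˡ-≤ r (*-monoˡ-≤ L q<) ⟩
      n / L * L + r      ≡⟨ n≡ ⟨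
      n                  ∎

-- The reflection of `x` to `c - x` carries `[0, u)` bijectively onto `[k, c]`, which is disjoint
-- from `[0, k)`. Each recursive step trades the last term of `f` for the term of `g` at `k`.
∑-reflect : ∀ u k c {f g} → k + u ≡ suc c → (∀ x y → x < u → y + x ≡ c → f x ≤ g y) →
  ∑ u f + ∑ k g ≤ ∑ (suc c) g
∑-reflect zero    k c eq f≤g =
  ≤-reflexive (cong (λ n → ∑ n _) (trans (sym (+-identityʳ k)) eq))
∑-reflect (suc u) k c {f} {g} eq f≤g = begin
  ∑ u f + f u + ∑ k g      ≤⟨ +-monoˡ-≤ (∑ k g) (+-monoʳ-≤ (∑ u f) (f≤g u k ≤-refl k+u≡c)) ⟩
  ∑ u f + g k + ∑ k g      ≡⟨ trans (+-assoc (∑ u f) (g k) _) (cong (∑ u f +_) (+-comm (g k) _)) ⟩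
  ∑ u f + ∑ (suc k) g      ≤⟨ ∑-reflect u (suc k) c (cong suc k+u≡c) (λ x y x<u → f≤g x y (m<n⇒m<1+n x<u)) ⟩
  ∑ (suc c) g              ∎
  where
  open ≤-Reasoning
  k+u≡c : k + u ≡ c
  k+u≡c = suc-injective (trans (sym (+-suc k u)) eq)

-- The bounds on `x` and `r` make this decidable by finite search, and `roth-step` splits on the
-- outcome.
Has3AP : (ℕ → Bool) → ℕ → Set
Has3AP A N = ∃ λ x → x < N × ∃ λ r → r < N ×
  0 < r × x + r + r < N × T (A x) × T (A (x + r)) × T (A (x + r + r))

has3AP? : ∀ A N → Dec (Has3AP A N)
has3AP? A N = anyUpTo? (λ x → anyUpTo? (λ r → 0 <? r ×-dec x + r + r <? N ×-dec
  T? (A x) ×-dec T? (A (x + r)) ×-dec T? (A (x + r + r))) N) N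

-- The density increment step.

-- Densities are fractions over the fixed denominator `D`: at least `s / D` for `A` on `[0, N)`, and
-- at most `(s + 1) / D` on every `L`-term progression. The bounds on `z` place `N` between `4 * u`
-- and `5 * u`. The factor `D * L` in `u` makes the total loss from at most `θ` exits come out as
-- exactly `u` in `complement-bound`.
module _ (D s L θ z : ℕ) .{{_ : NonZero D}} .{{_ : NonZero L}} (A : ℕ → Bool) where
  private
    u = D * L * θ
    v = z + u
    N = z + u + u

    Ic = ∑ u (λ x → ind (A x))
    Qc = ∑ u (λ x → ind (A (x + u)))
    Jc = ∑ v (λ x → ind (A (x + u)))

    -- So `M * θ` is `5 * u`, which bounds `N` and with it every value of `τ`.
    M = 5 * (D * L)

    instance
      5D≢0 : NonZero (5 * D)
      5D≢0 = m*n≢0 5 D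

    H = proj₁ (descent M (5 * D))

  module _
    (no3AP : ¬ Has3AP A N)
    (sparse : ∀ g x → 0 < g → x + g * L ≤ N → D * ∑ L (λ i → ind (A (x + g * i))) ≤ suc s * L)
    (dense : s * N ≤ D * # N ⟨ A ⟩)
    (2u≤z : u + u ≤ z) (z≤3u : z ≤ u + u + u) (0<u : 0 < u) (2DL≤u : 2 * (D * L) ≤ u)
    (6≤s : 6 ≤ s) (s-large : 6 * D + 4 * suc s + 1 ≤ s * suc s)
    (H≤N : H ≤ N) (2HL≤v : (H + H) * L ≤ v)
    where
    open ≤-Reasoning

    a : ℕ → ℕ
    a x = ind (A x)

    a≤1 : ∀ x → a x ≤ 1
    a≤1 x = ind≤1 (A x)

    4u≤N : u + u + (u + u) ≤ N
    4u≤N = ≤-trans (+-monoˡ-≤ (u + u) 2u≤z) (≤-reflexive (sym (+-assoc z u u)))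

    u≤N : u ≤ N
    u≤N = m≤n+m u _

    no3AP′ : ∀ p q y → p < q → y < N → y + p ≡ q + q → T (A p) → T (A q) → T (A y) → ⊥
    no3AP′ p q y p<q y<N eq Ap Aq Ay =
      no3AP (p , <-trans p<q q<N , r , ≤-<-trans (m∸n≤m q p) q<N , m<n⇒0<n∸m p<q ,
             subst (_< N) (sym p+2r) y<N , Ap , subst (T ∘ A) (sym p+r) Aq , subst (T ∘ A) (sym p+2r) Ay)
      where
      r = q ∸ p
      p+r : p + r ≡ q
      p+r = m+[n∸m]≡n (<⇒≤ p<q)
      p+2r : p + r + r ≡ y
      p+2r = +-cancelʳ-≡ p _ _ (begin-equality
        p + r + r + p      ≡⟨ trans (+-assoc (p + r) r p) (cong (p + r +_) (+-comm r p)) ⟩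
        p + r + (p + r)    ≡⟨ cong₂ _+_ p+r p+r ⟩
        q + q              ≡⟨ eq ⟨
        y + p              ∎)
      q<N : q < N
      q<N = ≰⇒> (λ N≤q → <⇒≱ (+-mono-<-≤ y<N (<⇒≤ p<q))
              (≤-trans (+-monoˡ-≤ q N≤q) (≤-reflexive (sym eq))))

    -- Blocks of `L` consecutive points are progressions of difference 1, so `sparse` applies to
    -- them; the leftover piece costs at most `D * L`.
    interval : ∀ x n → n + x ≤ N → D * ∑ n (λ i → a (i + x)) ≤ suc s * n + D * L
    interval x n n+x≤N = ∑-blocks D (suc s) L n (λ i → a (i + x)) (λ i → a≤1 (i + x)) λ y y+L≤n → begin
      D * ∑ L (λ i → a (i + y + x))          ≡⟨ cong (D *_) (∑-cong L (λ i → cong a (eq i y x))) ⟩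
      D * ∑ L (λ i → a (y + x + 1 * i))      ≤⟨ sparse 1 (y + x) ≤-refl (fits y y+L≤n) ⟩
      suc s * L                              ∎
      where
      eq : ∀ i y x → i + y + x ≡ y + x + 1 * i
      eq = solve-∀
      eq′ : ∀ y x l → y + x + 1 * l ≡ y + l + x
      eq′ = solve-∀
      fits : ∀ y → y + L ≤ n → y + x + 1 * L ≤ N
      fits y y+L≤n = ≤-trans (≤-reflexive (eq′ y x L)) (≤-trans (+-monoˡ-≤ x y+L≤n) n+x≤N)

    interval₀ : D * Ic ≤ suc s * u + D * L
    interval₀ = ≤-trans (≤-reflexive (cong (D *_) (∑-cong u (λ i → cong a (sym (+-identityʳ i))))))
      (interval 0 u (≤-trans (≤-reflexive (+-identityʳ u)) u≤N))

    split : # N ⟨ A ⟩ ≡ Ic + Jc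
    split = ∑-split u v a

    Zc : ℕ
    Zc = ∑ z (λ i → a (i + (u + u)))

    split₂ : Jc ≡ Qc + Zc
    split₂ = trans (∑-split u z (λ x → a (x + u)))
      (cong (Qc +_) (∑-cong z (λ x → cong a (+-assoc x u u))))

    N≤5u : N ≤ 5 * u
    N≤5u = ≤-trans (+-monoˡ-≤ u (+-monoˡ-≤ u z≤3u)) (≤-reflexive (eq u))
      where
      eq : ∀ u → u + u + u + u + u ≡ 5 * u
      eq = solve-∀

    -- `A` is hardly denser than average on `[0, u)` and on `[u + u, N)`, so it cannot be thin in
    -- between: `D * Qc` is at least `s * u - u - z - 2 * (D * L)`, and `6 ≤ s`, `z ≤ 3u` and
    -- `2 * (D * L) ≤ u` leave `u`.
    Q-dense : u ≤ D * Qc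
    Q-dense = linear 0 (+-mono-≤ (+-mono-≤ (+-mono-≤ (+-mono-≤ dense′ (*-monoˡ-≤ u 6≤s)) interval₀)
        (interval (u + u) z (≤-reflexive (sym (+-assoc z u u))))) (+-mono-≤ z≤3u 2DL≤u))
      (eq s z u (D * Ic) (D * Qc) (D * Zc) (D * L))
      where
      dense′ : s * N ≤ D * Ic + (D * Qc + D * Zc)
      dense′ = begin
        s * N                            ≤⟨ dense ⟩
        D * # N ⟨ A ⟩                    ≡⟨ cong (D *_) (trans split (cong (Ic +_) split₂)) ⟩
        D * (Ic + (Qc + Zc))             ≡⟨ trans (*-distribˡ-+ D Ic _) (cong (D * Ic +_) (*-distribˡ-+ D Qc Zc)) ⟩
        D * Ic + (D * Qc + D * Zc)       ∎
      eq : ∀ s z u i q w l → u + (i + (q + w) + s * u + (suc s * u + l) + (suc s * z + l) + (u + u + u + u)) + 0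
         ≡ q + (s * (z + u + u) + 6 * u + i + w + (z + 2 * l))
      eq = solve-∀

    B₀ : ℕ → Bool
    B₀ x = A x ∧ (⌊ u ≤? x ⌋ ∧ ⌊ x <? u + u ⌋)

    B₀-elim : ∀ x → T (B₀ x) → T (A x) × u ≤ x × x < u + u
    B₀-elim x Bx =
      let Ax , rest = Equivalence.to T-∧ Bx
          u≤x , x<2u = Equivalence.to (T-∧ {⌊ u ≤? x ⌋}) rest
      in Ax , toWitness u≤x , toWitness x<2u

    Qc≤B₀ : Qc ≤ # N ⟨ B₀ ⟩
    Qc≤B₀ = begin
      ∑ u (λ x → a (x + u))             ≤⟨ ∑-mono u (λ x x<u → ind-mono (λ Ax → Equivalence.from T-∧ (Ax ,
                                             Equivalence.from (T-∧ {⌊ u ≤? x + u ⌋}) (fromWitness (m≤n+m u x) , fromWitness (+-monoˡ-< u x<u))))) ⟩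
      ∑ u (λ x → ind (B₀ (x + u)))      ≤⟨ ∑-shift-upper u u _ ⟩
      # (u + u) ⟨ B₀ ⟩                  ≤⟨ ∑-extend _ (≤-trans (m≤m+n (u + u) (u + u)) 4u≤N) ⟩
      # N ⟨ B₀ ⟩                        ∎

    -- Reflections and their near-invariance under translation.

    reflections : (ℕ → Bool) → ℕ → Bool
    reflections B y =
      ⌊ anyUpTo? (λ q → T? (B q) ×-dec anyUpTo? (λ p → T? (A p) ×-dec y + p ≟ q + q) u) N ⌋

    reflections-intro : ∀ B {p q y} → T (B q) → q < N → T (A p) → p < u → y + p ≡ q + q → T (reflections B y)
    reflections-intro B Bq q<N Ap p<u eq = fromWitness (_ , q<N , Bq , _ , p<u , Ap , eq)

    reflections-elim : ∀ B y → T (reflections B y) →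
      ∃₂ λ p q → T (B q) × q < N × T (A p) × p < u × y + p ≡ q + q
    reflections-elim B y Ry with toWitness Ry
    ... | q , q<N , Bq , p , p<u , Ap , eq = p , q , Bq , q<N , Ap , p<u , eq

    τ : (ℕ → Bool) → ℕ
    τ B = # N ⟨ reflections B ⟩

    2u≤N : u + u ≤ N
    2u≤N = ≤-trans (m≤m+n (u + u) (u + u)) 4u≤N

    -- The density constant is `5 * D` because `N ≤ 5 * u` and `u ≤ D * Qc`; the budget suffices
    -- because `τ B₀ ≤ N ≤ M * θ`.
    found : ∃₂ λ B₁ B₂ → ∃ λ h → 1 ≤ h × h ≤ H × 1 ≤ # N ⟨ B₂ ⟩ ×
      (∀ x → T (B₁ x) → T (B₀ x)) × (∀ x → T (B₂ x) → T (B₁ x) × T (B₁ (x + h))) × τ B₁ ≤ τ B₂ + θ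
    found = proj₂ (descent M (5 * D)) N B₀ τ θ (≤-trans 0<u u≤N) H≤N
      (λ x B₀x → <-≤-trans (proj₂ (proj₂ (B₀-elim x B₀x))) 2u≤N)
      (begin
        N                      ≤⟨ N≤5u ⟩
        5 * u                  ≤⟨ *-monoʳ-≤ 5 (≤-trans Q-dense (*-monoʳ-≤ D Qc≤B₀)) ⟩
        5 * (D * # N ⟨ B₀ ⟩)   ≡⟨ *-assoc 5 D _ ⟨
        5 * D * # N ⟨ B₀ ⟩     ∎)
      (begin
        τ B₀                   ≤⟨ ∑-bound N (λ x _ → ind≤1 (reflections B₀ x)) ⟩
        N * 1                  ≡⟨ *-identityʳ N ⟩
        N                      ≤⟨ N≤5u ⟩
        5 * u                  ≡⟨ *-assoc 5 (D * L) θ ⟨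
        M * θ                  ∎)

    module _ (B₁ B₂ : ℕ → Bool) (h : ℕ) (1≤h : 1 ≤ h) (h≤H : h ≤ H) (B₂≢∅ : 1 ≤ # N ⟨ B₂ ⟩)
      (B₁⊆B₀ : ∀ x → T (B₁ x) → T (B₀ x))
      (B₂-shift : ∀ x → T (B₂ x) → T (B₁ x) × T (B₁ (x + h))) (τ-drop : τ B₁ ≤ τ B₂ + θ) where

      g : ℕ
      g = h + h

      S S₁ : ℕ → Bool
      S  = reflections B₂
      S₁ = reflections B₁

      B₁-elim : ∀ x → T (B₁ x) → T (A x) × u ≤ x × x < u + u
      B₁-elim x = B₀-elim x ∘ B₁⊆B₀ x

      B₂⊆B₁ : ∀ x → T (B₂ x) → T (B₁ x)
      B₂⊆B₁ x = proj₁ ∘ B₂-shift x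

      -- Write `y` as `2q - p` with `p < u ≤ q < 2u`. Then `u ≤ q ≤ y < 4u ≤ N`, and if `y` were in
      -- `A`, then `p`, `q`, `y` would form a 3-AP.
      S₁-elim : ∀ y → T (S₁ y) → u ≤ y × y < N × ¬ T (A y)
      S₁-elim y S₁y =
        let p , q , B₁q , q<N , Ap , p<u , eq = reflections-elim B₁ y S₁y
            Aq , u≤q , q<2u = B₁-elim q B₁q
            p<q = <-≤-trans p<u u≤q
            q≤y = +-cancelʳ-≤ q q y (≤-trans (≤-reflexive (sym eq)) (+-monoʳ-≤ y (<⇒≤ p<q)))
            y<N = ≤-<-trans (m≤m+n y p) (<-≤-trans (subst (_< u + u + (u + u)) (sym eq) (+-mono-< q<2u q<2u)) 4u≤N)
        in ≤-trans u≤q q≤y , y<N , no3AP′ p q y p<q y<N eq Ap Aq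

      S⊆S₁ : ∀ y → T (S y) → T (S₁ y)
      S⊆S₁ y Sy =
        let p , q , B₂q , q<N , Ap , p<u , eq = reflections-elim B₂ y Sy
        in reflections-intro B₁ (B₂⊆B₁ q B₂q) q<N Ap p<u eq

      -- If `y` is the reflection of `p` in `q`, then `y + 2h` is the reflection of `p` in `q + h`,
      -- which lies in `B₁`.
      S-shift : ∀ y → T (S y) → T (S₁ (y + g))
      S-shift y Sy =
        let p , q , B₂q , q<N , Ap , p<u , eq = reflections-elim B₂ y Sy
            B₁q+h = proj₂ (B₂-shift q B₂q)
        in reflections-intro B₁ B₁q+h (<-≤-trans (proj₂ (proj₂ (B₁-elim (q + h) B₁q+h))) 2u≤N) Ap p<u
             (trans (eq₁ y h p) (trans (cong (_+ (h + h)) eq) (eq₂ q h)))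
        where
        eq₁ : ∀ y h p → y + (h + h) + p ≡ y + p + (h + h)
        eq₁ = solve-∀
        eq₂ : ∀ q h → q + q + (h + h) ≡ q + h + (q + h)
        eq₂ = solve-∀

      -- A single `q` in `B₂` suffices, since reflection in `q` is injective on the points of `A`
      -- below `u`.
      Ic≤τ : Ic ≤ τ B₂
      Ic≤τ with count-witness N B₂ B₂≢∅
      ... | q , q<N , B₂q = begin
        Ic                                       ≤⟨ m≤m+n Ic _ ⟩
        Ic + ∑ (suc (q + q) ∸ u) (λ y → ind (S y))
          ≤⟨ ∑-reflect u (suc (q + q) ∸ u) (q + q) (m∸n+n≡m u≤) (λ p y p<u eq →
               ind-mono (λ Ap → reflections-intro B₂ B₂q q<N Ap p<u eq)) ⟩
        # (suc (q + q)) ⟨ S ⟩                    ≤⟨ ∑-extend _ (≤-trans (+-mono-< q<2u q<2u) 4u≤N) ⟩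
        # N ⟨ S ⟩                                ∎
        where
        q<2u : q < u + u
        q<2u = proj₂ (proj₂ (B₁-elim q (B₂⊆B₁ q B₂q)))
        u≤ : u ≤ suc (q + q)
        u≤ = ≤-trans (proj₁ (proj₂ (B₁-elim q (B₂⊆B₁ q B₂q)))) (≤-trans (m≤m+n q q) (n≤1+n _))

      exit : ℕ → Bool
      exit y = S y ∧ not (S (y + g))

      -- Translation by `g` sends exits injectively into `S₁` minus `S`, which has at most `θ`
      -- points because `S` lies in `S₁` and `τ` dropped by at most `θ`.
      exits≤θ : # N ⟨ exit ⟩ ≤ θ
      exits≤θ = +-cancelʳ-≤ (τ B₂) _ _ (begin
        # N ⟨ exit ⟩ + τ B₂                               ≤⟨ +-monoˡ-≤ (τ B₂) (∑-mono N (λ y _ → ind-mono (new y))) ⟩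
        ∑ N (λ y → ind (fresh (y + g))) + τ B₂            ≤⟨ +-monoˡ-≤ (τ B₂) (∑-shift-vanish g N _ (λ y N≤y →
                                                               ¬T⇒ind≤0 (λ Fy → <⇒≱ (proj₁ (proj₂ (S₁-elim y (proj₁ (Equivalence.to T-∧ Fy))))) N≤y))) ⟩
        # N ⟨ fresh ⟩ + τ B₂                              ≡⟨ ∑-distrib-+ N _ _ ⟨
        ∑ N (λ y → ind (fresh y) + ind (S y))             ≤⟨ ∑-mono N (λ y _ → disjoint (S₁ y) (S y) (S⊆S₁ y)) ⟩
        τ B₁                                              ≤⟨ τ-drop ⟩
        τ B₂ + θ                                          ≡⟨ +-comm (τ B₂) θ ⟩
        θ + τ B₂                                          ∎)
        where
        fresh : ℕ → Bool
        fresh y = S₁ y ∧ not (S y)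
        new : ∀ y → T (exit y) → T (fresh (y + g))
        new y Ey = let Sy , ¬Sy+g = Equivalence.to T-∧ Ey in Equivalence.from T-∧ (S-shift y Sy , ¬Sy+g)
        disjoint : ∀ b c → (T c → T b) → ind (b ∧ not c) + ind c ≤ ind b
        disjoint true  true  _   = ≤-refl
        disjoint true  false _   = ≤-refl
        disjoint false true  c⇒b = ⊥-elim (c⇒b _)
        disjoint false false _   = z≤n

      -- Progressions of difference `g` and the complement of `S`.

      -- `e` is the span of `L` steps of length `g`; a progression starting at `y + u` with `y < v′`
      -- stays below `N`.
      e v′ : ℕ
      e  = g * L
      v′ = v ∸ e

      v≡ : v ≡ v′ + e
      v≡ = sym (m∸n+n≡m (≤-trans (*-monoˡ-≤ L (+-mono-≤ h≤H h≤H)) 2HL≤v))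

      outside : ℕ
      outside = ∑ v′ (λ y → ind (not (S (y + u))))

      -- `S` has no point below `u` and at most `e` points in the last `e` positions; each of the
      -- remaining `v′` positions is either in `S` or counted by `outside`.
      outside+τ≤v : outside + τ B₂ ≤ v
      outside+τ≤v = begin
        outside + τ B₂                                      ≡⟨ cong (outside +_) (∑-split u v _) ⟩
        outside + (# u ⟨ S ⟩ + ∑ v (λ y → ind (S (y + u)))) ≤⟨ +-monoʳ-≤ outside (+-mono-≤
          (∑-zero u (λ y y<u → ¬T⇒ind≤0 (λ Sy → <⇒≱ y<u (proj₁ (S₁-elim y (S⊆S₁ y Sy))))))
          (≤-trans (≤-reflexive (cong (λ k → ∑ k (λ y → ind (S (y + u)))) v≡))
            (∑-tail v′ e (λ y → ind≤1 (S (y + u)))))) ⟩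
        outside + (∑ v′ (λ y → ind (S (y + u))) + e)        ≡⟨ +-assoc outside _ e ⟨
        outside + ∑ v′ (λ y → ind (S (y + u))) + e          ≡⟨ cong (_+ e) (∑-distrib-+ v′ _ _) ⟨
        ∑ v′ (λ y → ind (not (S (y + u))) + ind (S (y + u))) + e
          ≤⟨ +-monoˡ-≤ e (∑-bound v′ (λ y _ → one (S (y + u)))) ⟩
        v′ * 1 + e                                          ≡⟨ cong (_+ e) (*-identityʳ v′) ⟩
        v′ + e                                              ≡⟨ v≡ ⟨
        v                                                   ∎
        where
        one : ∀ b → ind (not b) + ind b ≤ 1
        one true  = ≤-refl
        one false = ≤-refl

      stays : ∀ n x → T (S x) → (∀ i → i < n → ¬ T (exit (x + g * i))) → T (S (x + g * n))
      stays zero    x Sx _    = subst (T ∘ S) (sym (trans (cong (x +_) (*-zeroʳ g)) (+-identityʳ x))) Sx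
      stays (suc n) x Sx none with stays n x Sx (λ i i<n → none i (m<n⇒m<1+n i<n))
      ... | Sn with T? (S (x + g * suc n))
      ...   | yes Sn+1 = Sn+1
      ...   | no ¬Sn+1 = contradiction (Equivalence.from T-∧ (Sn , T-not (subst (¬_ ∘ T ∘ S) (eq x g n) ¬Sn+1))) (none n ≤-refl)
        where
        eq : ∀ x g n → x + g * suc n ≡ x + g * n + g
        eq = solve-∀
        T-not : ∀ {b} → ¬ T b → T (not b)
        T-not {true}  ¬b = ¬b _
        T-not {false} _  = _

      -- A progression starting in S either stays in S, hence misses A, or meets an exit.
      pointwise : ∀ y → y < v′ → D * ∑ L (λ i → a (y + u + g * i)) ≤
        suc s * L * ind (not (S (y + u))) + D * L * ∑ L (λ i → ind (exit (y + u + g * i)))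
      pointwise y y<v′ with S (y + u) in eqS
      ... | false = begin
        D * ∑ L (λ i → a (y + u + g * i))    ≤⟨ sparse g (y + u) (≤-trans 1≤h (m≤m+n h h)) fits ⟩
        suc s * L                            ≡⟨ *-identityʳ _ ⟨
        suc s * L * 1                        ≤⟨ m≤m+n _ _ ⟩
        suc s * L * 1 + _                    ∎
        where
        eq : ∀ y u e → y + u + e ≡ y + e + u
        eq = solve-∀
        fits : y + u + g * L ≤ N
        fits = begin
          y + u + e      ≡⟨ eq y u e ⟩
          y + e + u      ≤⟨ +-monoˡ-≤ u (+-monoˡ-≤ e (<⇒≤ y<v′)) ⟩
          v′ + e + u     ≡⟨ cong (_+ u) v≡ ⟨
          N              ∎
      ... | true with anyUpTo? (λ i → T? (exit (y + u + g * i))) L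
      ...   | yes (i , i<L , Ei) = begin
        D * ∑ L (λ i → a (y + u + g * i))    ≤⟨ *-monoʳ-≤ D (∑-bound L (λ i _ → a≤1 _)) ⟩
        D * (L * 1)                          ≡⟨ *-assoc D L 1 ⟨
        D * L * 1
          ≤⟨ *-monoʳ-≤ (D * L) (≤-trans (T⇒1≤ind Ei) (∑-term (λ i → ind (exit (y + u + g * i))) i<L)) ⟩
        D * L * ∑ L (λ i → ind (exit (y + u + g * i)))    ≤⟨ m≤n+m _ (suc s * L * 0) ⟩
        _                                    ∎
      ...   | no none = begin
        D * ∑ L (λ i → a (y + u + g * i))    ≤⟨ *-monoʳ-≤ D (∑-zero L (λ i i<L → ¬T⇒ind≤0 (λ Ai →
                                                  proj₂ (proj₂ (S₁-elim _ (S⊆S₁ _ (inside i i<L)))) Ai))) ⟩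
        D * 0                                ≡⟨ *-zeroʳ D ⟩
        0                                    ≤⟨ z≤n ⟩
        _                                    ∎
        where
        inside : ∀ i → i < L → T (S (y + u + g * i))
        inside i i<L = stays i (y + u) (subst T (sym eqS) _) (λ j j<i Ej → none (j , <-trans j<i i<L , Ej))

      P : ℕ → ℕ
      P y = ∑ L (λ i → a (y + u + g * i))

      -- For each `i < L`, the points `y + u + g * i` with `y < v′` cover all but at most `e` points
      -- of `[u, N)`.
      lower : L * Jc ≤ L * e + ∑ v′ P
      lower = begin
        L * Jc                                                      ≡⟨ ∑-const L Jc ⟨
        ∑ L (λ _ → Jc)                                              ≤⟨ ∑-mono L shift ⟩
        ∑ L (λ i → e + ∑ v′ (λ y → a (y + u + g * i)))              ≡⟨ ∑-distrib-+ L _ _ ⟩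
        ∑ L (λ _ → e) + ∑ L (λ i → ∑ v′ (λ y → a (y + u + g * i)))  ≡⟨ cong₂ _+_ (∑-const L e) (∑-swap L v′ _) ⟩
        L * e + ∑ v′ P                                              ∎
        where
        eq : ∀ y c u → y + c + u ≡ y + u + c
        eq = solve-∀
        shift : ∀ i → i < L → Jc ≤ e + ∑ v′ (λ y → a (y + u + g * i))
        shift i i<L = begin
          Jc                                        ≡⟨ cong (λ k → ∑ k (λ x → a (x + u))) v≡ ⟩
          ∑ (v′ + e) (λ x → a (x + u))              ≤⟨ ∑-window v′ (λ x → a≤1 (x + u)) (*-monoʳ-≤ g (<⇒≤ i<L)) ⟩
          e + ∑ v′ (λ y → a (y + g * i + u))        ≡⟨ cong (e +_) (∑-cong v′ (λ y → cong a (eq y (g * i) u))) ⟩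
          e + ∑ v′ (λ y → a (y + u + g * i))        ∎

      exits : ∑ v′ (λ y → ∑ L (λ i → ind (exit (y + u + g * i)))) ≤ L * θ
      exits = begin
        ∑ v′ (λ y → ∑ L (λ i → ind (exit (y + u + g * i))))   ≡⟨ ∑-swap v′ L _ ⟩
        ∑ L (λ i → ∑ v′ (λ y → ind (exit (y + u + g * i))))   ≤⟨ ∑-bound L each ⟩
        L * θ                                                 ∎
        where
        each : ∀ i → i < L → ∑ v′ (λ y → ind (exit (y + u + g * i))) ≤ θ
        each i i<L = begin
          ∑ v′ (λ y → ind (exit (y + u + g * i)))      ≡⟨ ∑-cong v′ (λ y → cong (ind ∘ exit) (+-assoc y u (g * i))) ⟩
          ∑ v′ (λ y → ind (exit (y + (u + g * i))))    ≤⟨ ∑-shift-upper (u + g * i) v′ _ ⟩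
          # (v′ + (u + g * i)) ⟨ exit ⟩                ≤⟨ ∑-extend _ fits ⟩
          # N ⟨ exit ⟩                                 ≤⟨ exits≤θ ⟩
          θ                                            ∎
          where
          eq : ∀ y u e → y + (u + e) ≡ y + e + u
          eq = solve-∀
          fits : v′ + (u + g * i) ≤ N
          fits = begin
            v′ + (u + g * i)   ≤⟨ +-monoʳ-≤ v′ (+-monoʳ-≤ u (*-monoʳ-≤ g (<⇒≤ i<L))) ⟩
            v′ + (u + e)       ≡⟨ eq v′ u e ⟩
            v′ + e + u         ≡⟨ cong (_+ u) v≡ ⟨
            N                  ∎

      -- Sum `pointwise` over all starting points and divide by `L`. The exits contribute
      -- `D * L * (L * θ)`, which is `L * u`.
      complement-bound : D * Jc ≤ D * e + suc s * outside + u
      complement-bound = *-cancelˡ-≤ L (begin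
        L * (D * Jc)                               ≡⟨ eq₁ L D Jc ⟩
        D * (L * Jc)                               ≤⟨ *-monoʳ-≤ D lower ⟩
        D * (L * e + ∑ v′ P)
          ≡⟨ trans (*-distribˡ-+ D _ _) (cong (D * (L * e) +_) (sym (∑-distribˡ-* D v′ P))) ⟩
        D * (L * e) + ∑ v′ (λ y → D * P y)         ≤⟨ +-monoʳ-≤ (D * (L * e)) (∑-mono v′ pointwise) ⟩
        D * (L * e) + ∑ v′ (λ y → suc s * L * ind (not (S (y + u))) + D * L * ∑ L (λ i → ind (exit (y + u + g * i))))
          ≡⟨ cong (D * (L * e) +_) (trans (∑-distrib-+ v′ _ _) (cong₂ _+_ (∑-distribˡ-* (suc s * L) v′ _) (∑-distribˡ-* (D * L) v′ _))) ⟩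
        D * (L * e) + (suc s * L * outside + D * L * ∑ v′ (λ y → ∑ L (λ i → ind (exit (y + u + g * i)))))
          ≤⟨ +-monoʳ-≤ (D * (L * e)) (+-monoʳ-≤ (suc s * L * outside) (*-monoʳ-≤ (D * L) exits)) ⟩
        D * (L * e) + (suc s * L * outside + D * L * (L * θ))   ≡⟨ eq₂ L D e (suc s) outside θ ⟩
        L * (D * e + suc s * outside + u)          ∎)
        where
        eq₁ : ∀ l d j → l * (d * j) ≡ d * (l * j)
        eq₁ = solve-∀
        eq₂ : ∀ l d e s o t → d * (l * e) + (s * l * o + d * l * (l * t)) ≡ l * (d * e + s * o + d * l * t)
        eq₂ = solve-∀

      -- Contradictory bounds on the size of `S`.

      -- Up to errors, `A` beyond `u` is confined to the `v - τ B₂` points outside `S`, with density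
      -- at most `(s + 1) / D` there. A large `S` would leave too little room for `s * N`.
      τ-upper : suc s * τ B₂ ≤ N + D * L + D * e + u
      τ-upper = linear 0 (+-mono-≤ (+-mono-≤ (+-mono-≤ dense′ interval₀) complement-bound) (*-monoʳ-≤ (suc s) outside+τ≤v))
        (eq s z u (D * Ic) (D * Jc) (D * L) (D * e) outside (τ B₂))
        where
        dense′ : s * N ≤ D * Ic + D * Jc
        dense′ = ≤-trans dense (≤-reflexive (trans (cong (D *_) split) (*-distribˡ-+ D Ic Jc)))
        eq : ∀ s z u i j l e o t → suc s * t + (i + j + (suc s * u + l) + (e + suc s * o + u) + suc s * (z + u)) + 0
           ≡ z + u + u + l + e + u + (s * (z + u + u) + i + j + suc s * (o + t))
        eq = solve-∀

      -- Since `A` has density at most about `(s + 1) / D` on `[u, N)`, its part below `u` cannot be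
      -- small, and `Ic` bounds `τ B₂` from below.
      τ-lower : s * u ≤ D * τ B₂ + v + D * L
      τ-lower = linear 0 (+-mono-≤ (+-mono-≤ dense′ (*-monoʳ-≤ D Ic≤τ)) (interval u v ≤-refl))
        (eq s z u (D * Ic) (D * Jc) (D * L) (D * τ B₂))
        where
        dense′ : s * N ≤ D * Ic + D * Jc
        dense′ = ≤-trans dense (≤-reflexive (trans (cong (D *_) split) (*-distribˡ-+ D Ic Jc)))
        eq : ∀ s z u i j l t → s * u + (i + j + t + (suc s * (z + u) + l)) + 0
           ≡ t + (z + u) + l + (s * (z + u + u) + i + j)
        eq = solve-∀

      -- Eliminating `τ B₂` from the two bounds, with `N + u ≤ 6u` and `v ≤ 4u`, gives
      -- `s * suc s * u ≤ (6 * D + 4 * suc s) * u` plus terms free of `θ`. By `s-large` the left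
      -- side exceeds the main term by at least `u`.
      u-small : u ≤ D * (D * L + D * ((H + H) * L)) + suc s * (D * L)
      u-small = linear 0 (+-mono-≤ (+-mono-≤ (+-mono-≤ (*-monoʳ-≤ (suc s) τ-lower) (*-monoʳ-≤ D τ-upper))
          (+-mono-≤ (*-monoˡ-≤ u s-large) (*-monoʳ-≤ (suc s + D) z≤3u)))
          (*-monoʳ-≤ D (*-monoʳ-≤ D (*-monoˡ-≤ L (+-mono-≤ h≤H h≤H)))))
        (eq s D u z (D * L) (D * e) (D * ((H + H) * L)) (τ B₂))
        where
        eq : ∀ s d u z l e e′ t →
          u + (suc s * (d * t + (z + u) + l) + d * (z + u + u + l + e + u) + (s * suc s * u + (suc s + d) * (u + u + u)) + d * e′) + 0
          ≡ d * (l + e′) + suc s * l + (suc s * (s * u) + d * (suc s * t) + ((6 * d + 4 * suc s + 1) * u + (suc s + d) * z) + d * e)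
        eq = solve-∀

    increment : u ≤ D * (D * L + D * ((H + H) * L)) + suc s * (D * L)
    increment =
      let B₁ , B₂ , h , 1≤h , h≤H , B₂≢∅ , B₁⊆B₀ , B₂-shift , τ-drop = found
      in u-small B₁ B₂ h 1≤h h≤H B₂≢∅ B₁⊆B₀ B₂-shift τ-drop

-- Iterating the increment to Roth's theorem.

has3AP : ∀ {A N x} r → 0 < r → x + r + r < N → T (A x) → T (A (x + r)) → T (A (x + r + r)) → Has3AP A N
has3AP {x = x} r 0<r bound Ax Ax+r Ax+2r =
  x , ≤-<-trans (≤-trans (m≤m+n x r) (m≤m+n (x + r) r)) bound ,
  r , ≤-<-trans (m≤n+m r (x + r)) bound , 0<r , bound , Ax , Ax+r , Ax+2r

has3AP-affine : ∀ A L N g x → 0 < g → x + g * L ≤ N → Has3AP (λ i → A (x + g * i)) L → Has3AP A N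
has3AP-affine A L N g x 0<g fits (y , _ , r , _ , 0<r , bound , A₀ , A₁ , A₂) =
  has3AP (g * r) (*-mono-≤ 0<g 0<r)
    (<-≤-trans (subst (_< x + g * L) (sym (eq₂ x g y r)) (+-monoʳ-< x (*-monoʳ-< g {{>-nonZero 0<g}} bound))) fits)
    A₀ (subst (T ∘ A) (sym (eq₁ x g y r)) A₁) (subst (T ∘ A) (sym (eq₂ x g y r)) A₂)
  where
  eq₁ : ∀ x g y r → x + g * y + g * r ≡ x + g * (y + r)
  eq₁ = solve-∀
  eq₂ : ∀ x g y r → x + g * y + g * r + g * r ≡ x + g * (y + r + r)
  eq₂ = solve-∀

-- Take `θ = N / (4 * c)` and let `z` absorb the remainder, `z = u + u + N % (4 * c)`. For large `N`
-- the remainder is below `u`.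
quarters : ∀ c E → .{{_ : NonZero c}} → ∃ λ N₀ → ∀ N → N₀ ≤ N → ∃₂ λ θ z →
  N ≡ z + c * θ + c * θ × c * θ + c * θ ≤ z × z ≤ c * θ + c * θ + c * θ × E < c * θ
quarters c E = 4 * c + 4 * (E + 4 * c) , λ N N₀≤N →
  let instance 4c≢0 = m*n≢0 4 c
      θ  = N / (4 * c)
      r  = N % (4 * c)
      u  = c * θ
      N≡ : N ≡ u + u + r + u + u
      N≡ = trans (m≡m%n+[m/n]*n N (4 * c)) (eq c θ r)
      r<4c : r < 4 * c
      r<4c = m%n<n N (4 * c)
      large : E + 4 * c < u
      large = *-cancelˡ-< 4 _ _ (linear 0 (+-mono-≤ (≤-trans N₀≤N (≤-reflexive N≡)) r<4c) (eq′ c E u r))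
  in θ , u + u + r , N≡ , m≤m+n (u + u) r ,
     +-monoʳ-≤ (u + u) (≤-trans (<⇒≤ r<4c) (≤-trans (m≤n+m (4 * c) E) (<⇒≤ large))) ,
     ≤-<-trans (m≤m+n E (4 * c)) large
  where
  eq : ∀ c t r → r + t * (4 * c) ≡ c * t + c * t + r + c * t + c * t
  eq = solve-∀
  eq′ : ∀ c e u r → suc (4 * (e + 4 * c)) + (u + u + r + u + u + 4 * c) + 0
      ≡ 4 * u + (4 * c + 4 * (e + 4 * c) + suc r)
  eq′ = solve-∀

Roth : ℕ → ℕ → Set
Roth D s = ∃ λ N₀ → ∀ N → N₀ ≤ N → ∀ A → s * N ≤ D * # N ⟨ A ⟩ → Has3AP A N

-- If `A` has no 3-AP, neither has its restriction to any `L`-term progression, so the case `suc s`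
-- supplies the hypothesis `sparse`. Then `increment` bounds `u` by a constant, which fails for
-- large `N`.
roth-step : ∀ D s → .{{_ : NonZero D}} → 6 ≤ s → 6 * D + 4 * suc s + 1 ≤ s * suc s →
  Roth D (suc s) → Roth D s
roth-step D s 6≤s s-large (L₀ , denser) = proj₁ (quarters c E) , λ N N₀≤N A dense →
  let θ , z , N≡ , 2u≤z , z≤3u , E<u = proj₂ (quarters c E) N N₀≤N
  in find N A dense θ z N≡ 2u≤z z≤3u E<u
  where
  L = suc L₀
  c = D * L
  instance
    c≢0 : NonZero c
    c≢0 = m*n≢0 D L
  -- `H` is determined by `D` and `L`, so the threshold `E` can be fixed before `N` and `θ` are
  -- known.
  H = proj₁ (descent (5 * c) (5 * D) {{m*n≢0 5 D}})
  E₀ = D * (D * L + D * ((H + H) * L)) + suc s * (D * L)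
  -- `E₀` is the bound from `increment`; the other summands secure its largeness hypotheses.
  E = E₀ + (2 * c + (H + (H + H) * L))
  find : ∀ N A → s * N ≤ D * # N ⟨ A ⟩ → ∀ θ z → N ≡ z + c * θ + c * θ →
    c * θ + c * θ ≤ z → z ≤ c * θ + c * θ + c * θ → E < c * θ → Has3AP A N
  find N A dense θ z refl 2u≤z z≤3u E<u with has3AP? A N
  ... | yes found = found
  ... | no  none  = contradiction (≤-trans (increment D s L θ z A none sparse dense 2u≤z z≤3u
          (≤-<-trans z≤n E<u) (part (m≤m+n (2 * c) _)) 6≤s s-large
          (≤-trans (part (≤-trans (m≤m+n H _) (m≤n+m _ (2 * c)))) (m≤n+m u (z + u)))
          (≤-trans (part (≤-trans (m≤n+m ((H + H) * L) H) (m≤n+m _ (2 * c)))) (m≤n+m u z)))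
          (m≤m+n E₀ _)) (<⇒≱ E<u)
    where
    u = c * θ
    part : ∀ {x} → x ≤ 2 * c + (H + (H + H) * L) → x ≤ u
    part x≤ = ≤-trans x≤ (≤-trans (m≤n+m _ E₀) (<⇒≤ E<u))
    sparse : ∀ g x → 0 < g → x + g * L ≤ N → D * ∑ L (λ i → ind (A (x + g * i))) ≤ suc s * L
    sparse g x 0<g fits with ≤-total (D * ∑ L (λ i → ind (A (x + g * i)))) (suc s * L)
    ... | inj₁ few  = few
    ... | inj₂ many = contradiction
      (has3AP-affine A L N g x 0<g fits (denser L (n≤1+n L₀) (λ i → A (x + g * i)) many)) none

-- A density of `(D + 1) / D` is impossible; this is where the increments must stop.
roth-trivial : ∀ D → Roth D (suc D)
roth-trivial D = 1 , λ N 1≤N A dense → contradiction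
  (≤-trans dense (*-monoʳ-≤ D (≤-trans (∑-bound N (λ x _ → ind≤1 (A x))) (≤-reflexive (*-identityʳ N)))))
  (<⇒≱ (+-monoˡ-≤ (D * N) 1≤N))

abstract
  -- With `D = 16 * K * K`, the density 1/K is `16 * K / D`. Downward induction on `s` from `suc D`
  -- to `16 * K` makes each increment `1 / D`, quadratic in the density.
  roth : ∀ K → .{{_ : NonZero K}} → ∃ λ N₀ → ∀ N → N₀ ≤ N → ∀ A → N ≤ K * # N ⟨ A ⟩ → Has3AP A N
  roth K =
    let N₀ , dense⇒3AP = descend (suc D ∸ 16 * K) (16 * K) ≤-refl (m∸n+n≡m (m≤n⇒m≤1+n 16K≤D))
    in N₀ , λ N N₀≤N A dense → dense⇒3AP N N₀≤N A
         (≤-trans (*-monoʳ-≤ (16 * K) dense) (≤-reflexive (sym (*-assoc (16 * K) K _))))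
    where
    D : ℕ
    D = 16 * K * K
    instance
      D≢0 : NonZero D
      D≢0 = m*n≢0 (16 * K) K {{m*n≢0 16 K}}
    16K≤D : 16 * K ≤ D
    16K≤D = m≤m*n (16 * K) K
    16≤16K : 16 ≤ 16 * K
    16≤16K = m≤m*n 16 K
    -- `16 * D` is the square of `16 * K`, so `D` is at most a sixteenth of `s * s`; the lower-order
    -- terms are absorbed using `16 ≤ s`.
    s-large : ∀ s → 16 * K ≤ s → 6 * D + 4 * suc s + 1 ≤ s * suc s
    s-large s 16K≤s = *-cancelˡ-≤ 16 (linear (6 * (s * s) + 11 * s)
      (+-mono-≤ (+-mono-≤ (*-monoʳ-≤ 6 (*-mono-≤ 16K≤s 16K≤s)) (*-monoʳ-≤ 4 (*-monoˡ-≤ s 16≤s))) (*-monoʳ-≤ 5 16≤s))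
      (eq K s))
      where
      16≤s : 16 ≤ s
      16≤s = ≤-trans 16≤16K 16K≤s
      eq : ∀ k s → 16 * (6 * (16 * k * k) + 4 * suc s + 1) + (6 * (s * s) + 4 * (s * s) + 5 * s) + (6 * (s * s) + 11 * s)
         ≡ 16 * (s * suc s) + (6 * (16 * k * (16 * k)) + 4 * (16 * s) + 5 * 16)
      eq = solve-∀
    descend : ∀ k s → 16 * K ≤ s → k + s ≡ suc D → Roth D s
    descend zero    s _     eq = subst (Roth D) (sym eq) (roth-trivial D)
    descend (suc k) s 16K≤s eq = roth-step D s
      (≤-trans (m≤m+n 6 10) (≤-trans 16≤16K 16K≤s)) (s-large s 16K≤s)
      (descend k (suc s) (m≤n⇒m≤1+n 16K≤s) (trans (+-suc k s) eq))

  -- From Roth's theorem to configurations.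

  -- `supersaturation` with 3-APs as patterns: windows are taken long enough for Roth's theorem at
  -- density 1/(2K).
  popular-3AP : ∀ K → .{{_ : NonZero K}} → ∃₂ λ N₀ K′ → NonZero K′ × ∀ N (A : ℕ → Bool) →
    N₀ ≤ N → (∀ x → T (A x) → x < N) → N ≤ K * # N ⟨ A ⟩ →
    ∃ λ r → 0 < r × N ≤ K′ * # N ⟨ (λ x → A x ∧ (A (x + r) ∧ A (x + r + r))) ⟩
  popular-3AP K = suc (4 * K * W) , 4 * K * W * W ,
    m*n≢0 (4 * K * W) W {{m*n≢0 (4 * K) W {{m*n≢0 4 K}}}} , λ N A N₀≤N A<N dense →
      let r , _ , N≤ = supersaturation K W A (λ r x → A x ∧ (A (x + suc r) ∧ A (x + suc r + suc r))) N
            (≤-trans (s≤s z≤n) N₀≤N) (<⇒≤ N₀≤N) A<N (λ r x → proj₁ ∘ Equivalence.to T-∧) (hits A) dense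
      in suc r , s≤s z≤n , N≤
    where
    2K≢0 : NonZero (2 * K)
    2K≢0 = m*n≢0 2 K
    W : ℕ
    W = suc (proj₁ (roth (2 * K) {{2K≢0}}))
    hits : ∀ (A : ℕ → Bool) y → W < 2 * K * # W ⟨ (λ i → A (y + i)) ⟩ →
      ∃₂ λ r i → r < W × i < W × T (A (y + i) ∧ (A (y + i + suc r) ∧ A (y + i + suc r + suc r)))
    hits A y many with proj₂ (roth (2 * K) {{2K≢0}}) W (n≤1+n _) (λ i → A (y + i)) (<⇒≤ many)
    ... | i , i<W , suc r , r<W , _ , _ , A₀ , A₁ , A₂ =
      r , i , <⇒≤ r<W , i<W , Equivalence.from (T-∧ {A (y + i)}) (A₀ , Equivalence.from (T-∧ {A (y + i + suc r)})
        (subst (T ∘ A) (sym (+-assoc y i (suc r))) A₁ ,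
         subst (T ∘ A) (sym (trans (cong (_+ suc r) (+-assoc y i (suc r))) (+-assoc y (i + suc r) (suc r)))) A₂))

-- If A′ = {x : x, x + r, x + 2r ∈ A} contains nᵢ + nⱼ + a for i, j ≤ d, then A contains the
-- configuration of n₀, n₀ + r, n₁ + r, …, n_d + r with the same a.
dense⇒config : ∀ d K → .{{_ : NonZero K}} → ∃ λ N₀ → ∀ N (A : ℕ → Bool) →
  N₀ ≤ N → (∀ x → T (A x) → x < N) → N ≤ K * # N ⟨ A ⟩ →
  ∃₂ λ a (n : ℕ → ℕ) → (∀ i → n i < n (suc i)) × (∀ i j → i ≤ d → j ≤ d → T (A (n i + n j + a)))
-- Only index 0 is tested, and `0 + 0 + a` is `a`, so the identity serves as the increasing
-- sequence.
dense⇒config zero K = 1 , λ N A 1≤N A<N dense →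
  let a , _ , Aa = count-witness N A (positive-factor K 1≤N dense)
  in a , (λ i → i) , (λ i → ≤-refl) , λ { zero zero _ _ → Aa }
dense⇒config (suc d) K with popular-3AP K
... | N₁ , K′ , K′≢0 , popular with dense⇒config d K′ {{K′≢0}}
...   | N₂ , config = N₁ + N₂ , step
  where
  step : ∀ N (A : ℕ → Bool) → N₁ + N₂ ≤ N → (∀ x → T (A x) → x < N) → N ≤ K * # N ⟨ A ⟩ →
    ∃₂ λ a (n : ℕ → ℕ) → (∀ i → n i < n (suc i)) × (∀ i j → i ≤ suc d → j ≤ suc d → T (A (n i + n j + a)))
  step N A N₀≤N A<N dense with popular N A (m+n≤o⇒m≤o N₁ N₀≤N) A<N dense
  ... | r , 0<r , dense′ with config N (λ x → A x ∧ (A (x + r) ∧ A (x + r + r))) (m+n≤o⇒n≤o N₁ N₀≤N)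
                                (λ x → A<N x ∘ proj₁ ∘ Equivalence.to T-∧) dense′
  ...   | a , n , n-mono , A′n = a , n′ , n′-mono , An′
    where
    n′ : ℕ → ℕ
    n′ zero    = n zero
    n′ (suc i) = n i + r
    n′-mono : ∀ i → n′ i < n′ (suc i)
    n′-mono zero    = m<m+n (n zero) 0<r
    n′-mono (suc i) = +-monoˡ-< r (n-mono i)
    elim : ∀ x → T (A x ∧ (A (x + r) ∧ A (x + r + r))) → T (A x) × T (A (x + r)) × T (A (x + r + r))
    elim x A′x = let Ax , rest = Equivalence.to T-∧ A′x in Ax , Equivalence.to (T-∧ {A (x + r)}) rest
    eq₁ : ∀ x y r a → x + y + a + r ≡ x + (y + r) + a
    eq₁ = solve-∀
    eq₂ : ∀ x y r a → x + y + a + r ≡ x + r + y + a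
    eq₂ = solve-∀
    eq₃ : ∀ x y r a → x + y + a + r + r ≡ x + r + (y + r) + a
    eq₃ = solve-∀
    An′ : ∀ i j → i ≤ suc d → j ≤ suc d → T (A (n′ i + n′ j + a))
    An′ zero    zero    _         _         = proj₁ (elim _ (A′n 0 0 z≤n z≤n))
    An′ zero    (suc j) _         (s≤s j≤d) =
      subst (T ∘ A) (eq₁ (n 0) (n j) r a) (proj₁ (proj₂ (elim _ (A′n 0 j z≤n j≤d))))
    An′ (suc i) zero    (s≤s i≤d) _         =
      subst (T ∘ A) (eq₂ (n i) (n 0) r a) (proj₁ (proj₂ (elim _ (A′n i 0 i≤d z≤n))))
    An′ (suc i) (suc j) (s≤s i≤d) (s≤s j≤d) =
      subst (T ∘ A) (eq₃ (n i) (n j) r a) (proj₂ (proj₂ (elim _ (A′n i j i≤d j≤d))))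

-- Lists, rational densities and the final assembly.

ind-disjoint : ∀ {b c d} → (T b → T d) → (T c → T d) → ¬ (T b × T c) → ind b + ind c ≤ ind d
ind-disjoint {true}  {true}  _   _   ¬bc = contradiction (_ , _) ¬bc
ind-disjoint {true}  {false} b⇒d _   _   = ind-mono {true} b⇒d
ind-disjoint {false} {_}     _   c⇒d _   = ind-mono c⇒d

-- Uniqueness keeps the head apart from the tail, so each list entry contributes its own point to
-- the count.
length≤count : ∀ n A → Unique A → All (_< n) A → length A ≤ # n ⟨ (λ x → ⌊ x ∈? A ⌋) ⟩
length≤count n []      _              _            = z≤n
length≤count n (y ∷ A) (y∉A ∷ unique) (y<n ∷ A<n) = begin
  suc (length A)                                        ≤⟨ s≤s (length≤count n A unique A<n) ⟩
  1 + # n ⟨ (λ x → ⌊ x ∈? A ⌋) ⟩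
    ≤⟨ +-monoˡ-≤ _ (≤-trans (T⇒1≤ind (fromWitness refl)) (∑-term (λ x → ind ⌊ x ≟ y ⌋) y<n)) ⟩
  # n ⟨ (λ x → ⌊ x ≟ y ⌋) ⟩ + # n ⟨ (λ x → ⌊ x ∈? A ⌋) ⟩  ≡⟨ ∑-distrib-+ n _ _ ⟨
  ∑ n (λ x → ind ⌊ x ≟ y ⌋ + ind ⌊ x ∈? A ⌋)
    ≤⟨ ∑-mono n (λ x _ → ind-disjoint (head x) (tail x) (apart x)) ⟩
  # n ⟨ (λ x → ⌊ x ∈? (y ∷ A) ⌋) ⟩                      ∎
  where
  open ≤-Reasoning
  head : ∀ x → T ⌊ x ≟ y ⌋ → T ⌊ x ∈? (y ∷ A) ⌋
  head x x≡y = fromWitness {a? = x ∈? (y ∷ A)} (here (toWitness {a? = x ≟ y} x≡y))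
  tail : ∀ x → T ⌊ x ∈? A ⌋ → T ⌊ x ∈? (y ∷ A) ⌋
  tail x x∈A = fromWitness {a? = x ∈? (y ∷ A)} (there (toWitness {a? = x ∈? A} x∈A))
  apart : ∀ x → ¬ (T ⌊ x ≟ y ⌋ × T ⌊ x ∈? A ⌋)
  apart x (x≡y , x∈A) =
    All.lookup y∉A (toWitness {a? = x ∈? A} x∈A) (sym (toWitness {a? = x ≟ y} x≡y))

-- A positive rational `p / q` has `p ≥ 1`, so `N ≤ p * N ≤ q * m`. Passing to unnormalised
-- rationals turns the hypothesis into this cross-multiplied inequality.
density-bound : ∀ α → 0ℚ <ℚ α → ∀ N m → α *ℚ ℕ→ℚ N ≤ℚ ℕ→ℚ m → N ≤ ℚ.denominatorℕ α * m
density-bound (ℚ.mkℚ (ℤ.+ zero) _ _)  (ℚ.*<* (ℤ.+<+ ())) _ _ _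
density-bound (ℚ.mkℚ ℤ.-[1+ _ ] _ _) (ℚ.*<* ())         _ _ _
density-bound α@(ℚ.mkℚ (ℤ.+ suc p) q-1 _) _ N m αN≤m with
  ℚᵘ.≤-respʳ-≃ (ℚ.toℚᵘ-fromℚᵘ (mkℚᵘ (ℤ.+ m) 0)) (ℚᵘ.≤-respˡ-≃
    (ℚᵘ.≃-trans (ℚ.toℚᵘ-homo-* α (ℕ→ℚ N)) (ℚᵘ.*-congˡ {ℚ.toℚᵘ α} (ℚ.toℚᵘ-fromℚᵘ (mkℚᵘ (ℤ.+ N) 0))))
    (ℚ.toℚᵘ-mono-≤ αN≤m))
... | *≤* h = begin
  N                    ≤⟨ m≤n*m N (suc p) ⟩
  suc p * N            ≡⟨ *-identityʳ _ ⟨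
  suc p * N * 1        ≤⟨ ℤ.drop‿+≤+ (subst₂ ℤ._≤_
                            (trans (cong (ℤ._* (ℤ.+ 1)) (sym (ℤ.pos-* (suc p) N))) (sym (ℤ.pos-* (suc p * N) 1)))
                            (sym (ℤ.pos-* m (suc q-1 * 1))) h) ⟩
  m * (suc q-1 * 1)    ≡⟨ trans (cong (m *_) (*-identityʳ (suc q-1))) (*-comm m (suc q-1)) ⟩
  suc q-1 * m          ∎
  where open ≤-Reasoning

strictly-increasing : ∀ (n : ℕ → ℕ) → (∀ i → n i < n (suc i)) → ∀ {i j} → i < j → n i < n j
strictly-increasing n n-mono {i} {suc j} (s≤s i≤j) with m≤n⇒m<n∨m≡n i≤j
... | inj₁ i<j  = <-trans (strictly-increasing n n-mono i<j) (n-mono j)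
... | inj₂ refl = n-mono i

theorem1p2 : (α : ℚ) → 0ℚ <ℚ α → α <ℚ 1ℚ → (d : ℕ) → 1 ≤ d →
    ∃ λ (N₀ : ℕ) → ∀ (N : ℕ) → N₀ ≤ N →
    ∀ (A : List ℕ) → IsSubsetOfInterval N A →
    α *ℚ ℕ→ℚ N ≤ℚ ℕ→ℚ (length A) →
    ContainsNonTrivialConfig d A
theorem1p2 α 0<α _ (suc d) _ = suc (proj₁ configs) , contains
  where
  -- The factor 2 pays for replacing `N` by `suc N`, since `A` lies in `[0, N + 1)` and `N` is at
  -- least 1.
  K : ℕ
  K = 2 * ℚ.denominatorℕ α
  -- The indices 0 to `d` provide the `suc d` numbers of the configuration.
  configs = dense⇒config d K {{m*n≢0 2 (ℚ.denominatorℕ α)}}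
  contains : ∀ N → suc (proj₁ configs) ≤ N → ∀ A → IsSubsetOfInterval N A →
    α *ℚ ℕ→ℚ N ≤ℚ ℕ→ℚ (length A) → ContainsNonTrivialConfig (suc d) A
  contains N N₀<N A (unique , within) αN≤ =
    let a , n , n-mono , An = proj₂ configs (suc N) A′ (m≤n⇒m≤1+n (<⇒≤ N₀<N)) A′<N dense
    in a , (λ i → n (toℕ i)) , distinct n n-mono ,
       (λ i j _ → toWitness {a? = _ ∈? A} (An (toℕ i) (toℕ j) (toℕ≤pred[n] i) (toℕ≤pred[n] j)))
    where
    A<1+N : All (_< suc N) A
    A<1+N = All.map (s≤s ∘ proj₂) within
    A′ : ℕ → Bool
    A′ x = ⌊ x ∈? A ⌋
    A′<N : ∀ x → T (A′ x) → x < suc N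
    A′<N x x∈A = All.lookup A<1+N (toWitness {a? = x ∈? A} x∈A)
    dense : suc N ≤ K * # (suc N) ⟨ A′ ⟩
    dense = begin
      1 + N                                       ≤⟨ +-monoˡ-≤ N (≤-trans (s≤s z≤n) N₀<N) ⟩
      N + N                                       ≡⟨ cong (N +_) (+-identityʳ N) ⟨
      2 * N                                       ≤⟨ *-monoʳ-≤ 2 (density-bound α 0<α N (length A) αN≤) ⟩
      2 * (ℚ.denominatorℕ α * length A)           ≡⟨ *-assoc 2 (ℚ.denominatorℕ α) _ ⟨
      K * length A                                ≤⟨ *-monoʳ-≤ K (length≤count (suc N) A unique A<1+N) ⟩
      K * # (suc N) ⟨ A′ ⟩                        ∎
      where open ≤-Reasoning
    distinct : ∀ n → (∀ i → n i < n (suc i)) → NonTrivial (suc d) (λ i → n (toℕ i))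
    distinct n n-mono i j i≢j ni≡nj with <-cmp (toℕ i) (toℕ j)
    ... | tri< i<j _ _ = <⇒≢ (strictly-increasing n n-mono i<j) ni≡nj
    ... | tri≈ _ i≡j _ = i≢j (toℕ-injective i≡j)
    ... | tri> _ _ j<i = <⇒≢ (strictly-increasing n n-mono j<i) (sym ni≡nj)
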